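{- For every integer $n\geq 3$, writing $f_q(n)$ for the total number of occurrences of the pattern $q$ in all permutations of $S_n(123,132,312)$, we have $$f_{213}(n)=f_{231}(n)=\binom{n}{3},\qquad f_{321}(n)=(n-2)\binom{n}{3}.$$
   Context: $S_n$ is the set of permutations of $\{1,\dots,n\}$ written in one-line notation $\sigma=\sigma_1\sigma_2\cdots\sigma_n$. For $q\in S_k$, an occurrence of the pattern $q$ in $\sigma\in S_n$ is a choice of indices $i_1<i_2<\cdots<i_k$ in $\{1,\dots,n\}$ such that for all $1\le j,l\le k$, $q_j<q_l$ if and only if $\sigma_{i_j}<\sigma_{i_l}$. Let $f_q(\sigma)$ be the number of occurrences of $q$ in $\sigma$; $\sigma$ avoids $q$ if $f_q(\sigma)=0$. $S_n(123,132,312)$ is the set of permutations in $S_n$ avoiding all of $123$, $132$ and $312$, and $f_q(n)=\sum_{\sigma\in S_n(123,132,312)}f_q(\sigma)$. -}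

module Defs where

open import Data.Fin using (Fin; _<_)
open import Data.Fin.Patterns using (0F; 1F; 2F)
open import Data.Fin.Properties using (_≟_; _<?_; all?)
open import Data.List using (List; [_]; allFin; cartesianProductWith; filter; length; map)
open import Data.Nat using (ℕ; zero; suc)
import Data.Nat.Properties as ℕ
open import Data.Nat.ListAction using (sum)
open import Data.Product using (_×_; _,_; uncurry)
open import Data.Vec using (Vec; []; _∷_; lookup)
open import Data.Vec.Relation.Unary.AllPairs using (AllPairs; allPairs?)
open import Data.Vec.Relation.Unary.Unique.Propositional using (Unique)
open import Function using (_⇔_; mk⇔; Equivalence)
open import Relation.Binary.PropositionalEquality using (_≡_)
open import Relation.Nullary.Decidable using (Dec; map′; ¬?; _×-dec_; _→-dec_)

-- Positions and values are 0-based: the entry σᵢ of a permutation in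
-- one-line notation is stored, decreased by one, at index i - 1.
Word : ℕ → Set
Word n = Vec (Fin n) n

-- A word of length n over n letters is a permutation exactly when its
-- entries are pairwise distinct.
IsPermutation : ∀ {n} → Word n → Set
IsPermutation = Unique

isPermutation? : ∀ {n} (σ : Word n) → Dec (IsPermutation σ)
isPermutation? = allPairs? (λ x y → ¬? (x ≟ y))

-- All k-tuples over Fin n, each listed exactly once.
tuples : ∀ k n → List (Vec (Fin n) k)
tuples zero    n = [ [] ]
tuples (suc k) n = cartesianProductWith _∷_ (allFin n) (tuples k n)

permutations : ∀ n → List (Word n)
permutations n = filter isPermutation? (tuples n n)

Increasing : ∀ {k n} → Vec (Fin n) k → Set
Increasing = AllPairs _<_

SameOrder : ∀ {k n} → Word k → Word n → Vec (Fin n) k → Set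
SameOrder q σ i = ∀ j l →
  lookup q j < lookup q l ⇔ lookup σ (lookup i j) < lookup σ (lookup i l)

IsOccurrence : ∀ {k n} → Word k → Word n → Vec (Fin n) k → Set
IsOccurrence q σ i = Increasing i × SameOrder q σ i

isOccurrence? : ∀ {k n} (q : Word k) (σ : Word n) (i : Vec (Fin n) k) →
                Dec (IsOccurrence q σ i)
isOccurrence? q σ i = allPairs? _<?_ i ×-dec
  all? (λ j → all? (λ l →
    (lookup q j <? lookup q l) ⇔?
    (lookup σ (lookup i j) <? lookup σ (lookup i l))))
  where
  _⇔?_ : ∀ {A B : Set} → Dec A → Dec B → Dec (A ⇔ B)
  a? ⇔? b? = map′ (uncurry mk⇔)
                  (λ e → Equivalence.to e , Equivalence.from e)
                  ((a? →-dec b?) ×-dec (b? →-dec a?))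

occurrences : ∀ {k n} → Word k → Word n → ℕ
occurrences {k} {n} q σ = length (filter (isOccurrence? q σ) (tuples k n))

Avoids : ∀ {k n} → Word k → Word n → Set
Avoids q σ = occurrences q σ ≡ 0

avoids? : ∀ {k n} (q : Word k) (σ : Word n) → Dec (Avoids q σ)
avoids? q σ = occurrences q σ ℕ.≟ 0

p123 p132 p213 p231 p312 p321 : Word 3
p123 = 0F ∷ 1F ∷ 2F ∷ []
p132 = 0F ∷ 2F ∷ 1F ∷ []
p213 = 1F ∷ 0F ∷ 2F ∷ []
p231 = 1F ∷ 2F ∷ 0F ∷ []
p312 = 2F ∷ 0F ∷ 1F ∷ []
p321 = 2F ∷ 1F ∷ 0F ∷ []

avoiders : ∀ n → List (Word n)
avoiders n =
  filter (λ σ → avoids? p123 σ ×-dec avoids? p132 σ ×-dec avoids? p312 σ)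
         (permutations n)

-- f q n is the total number of occurrences of q over S_n(123,132,312).
f : ∀ {k} → Word k → ℕ → ℕ
f q n = sum (map (occurrences q) (avoiders n))

{-# OPTIONS --safe #-}

-- In a permutation avoiding 123, 132 and 312 the entries other than the maximum decrease, since
-- together with the maximum a rising pair of them would form 123, 132 or 312, according to
-- whether the maximum stands to the right of, between or to the left of the pair. Hence the
-- avoiders correspond to the position p of the maximum, and the only rises are those ending at p.
-- Counting pairs of an increasing triple i < j < l of positions and a p by the triple first: the
-- triple is an occurrence of 213 exactly for p = l, of 231 exactly for p = j, and of 321 exactly
-- for the n − 2 positions p other than j and l; and there are C(n,3) triples.
module Submission where

open import Defs
open import Data.Nat using (ℕ; _≥_; _*_; _∸_)
open import Data.Nat.Combinatorics using (_C_)
open import Data.Product using (_×_)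
open import Relation.Binary.PropositionalEquality using (_≡_)

open import Data.Empty using (⊥-elim)
open import Data.Fin
  using (Fin; zero; suc; toℕ; fromℕ; inject₁; opposite; punchIn; punchOut; _<_; _≤_)
open import Data.Fin.Patterns using (0F; 1F; 2F)
open import Data.Fin.Properties
  using ( _≟_; _<?_; <-cmp; ≤∧≢⇒<; suc-injective; toℕ-injective; toℕ-fromℕ; toℕ-inject₁; toℕ<n
        ; opposite-prop; opposite-involutive
        ; punchIn-cancel-≤; punchIn-mono-≤; punchIn-injective; punchIn-punchOut; punchInᵢ≢i)
open import Data.List using (List; []; _∷_; _++_; [_]; allFin; filter; length; map)
open import Data.List.Extrema.Nat using (argmax; f[xs]≤f[argmax])
open import Data.List.Membership.Propositional using (_∈_)
open import Data.List.Membership.Propositional.Properties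
  using ( ∈-allFin; ∈-cartesianProductWith⁺; ∈-filter⁺; ∈-filter⁻; ∈-map⁺; ∈-map⁻
        ; ∈-++⁺ˡ; ∈-++⁺ʳ; ∈-++⁻)
open import Data.List.Membership.Propositional.Properties.WithK using (unique∧set⇒bag)
open import Data.List.Properties
  using (filter-none; length-++; length-map; length-tabulate; map-cong; map-∘)
open import Data.List.Relation.Binary.BagAndSetEquality using (∼bag⇒↭)
open import Data.List.Relation.Binary.Permutation.Propositional using (_↭_)
open import Data.List.Relation.Binary.Permutation.Propositional.Properties as ↭ using (↭-length)
open import Data.List.Relation.Unary.All as List using ([]; _∷_)
open import Data.List.Relation.Unary.AllPairs using ([]; _∷_)
open import Data.List.Relation.Unary.Any using (here; there)
open import Data.List.Relation.Unary.Unique.Propositional using (Unique)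
open import Data.List.Relation.Unary.Unique.Propositional.Properties
  using (allFin⁺; cartesianProductWith⁺; filter⁺; map⁺; ++⁺)
open import Data.Nat using (suc; zero; _+_; s≤s; z≤n; z<s; s<s; s<s⁻¹)
import Data.Nat as ℕ
open import Data.Nat.Combinatorics using (nCk+nC[k+1]≡[n+1]C[k+1])
open import Data.Nat.ListAction using (sum)
open import Data.Nat.ListAction.Properties using (sum-↭)
import Data.Nat.Properties as ℕ
open import Data.Product using (_,_; proj₁; proj₂; ∃)
open import Data.Sum using (inj₁; inj₂)
open import Data.Vec as Vec using (Vec; []; _∷_; lookup; insertAt; tabulate)
open import Data.Vec.Properties
  using ( ∷-injective; insertAt-lookup; insertAt-punchIn; lookup∘tabulate
        ; tabulate∘lookup; tabulate-cong)
open import Data.Vec.Relation.Unary.All as VecAll using ([]; _∷_)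
import Data.Vec.Relation.Unary.All.Properties as VecAll
open import Data.Vec.Relation.Unary.AllPairs as AllPairs using ([]; _∷_)
import Data.Vec.Relation.Unary.AllPairs.Properties as AllPairs
open import Data.Vec.Relation.Unary.Unique.Propositional.Properties as Unique using (lookup-injective)
open import Function using (_∘_; _⇔_; mk⇔; Equivalence)
open import Relation.Binary using (tri<; tri≈; tri>)
open import Relation.Binary.PropositionalEquality
  using (_≢_; refl; sym; trans; cong; cong₂; subst; subst₂; module ≡-Reasoning)
open import Relation.Nullary using (¬_; Dec; yes; no; contradiction)
open import Relation.Nullary.Decidable using (True; False; _×-dec_; toWitness; toWitnessFalse)
open import Relation.Unary using (Decidable)
open Equivalence using (to; from)

-- The comparison between two letters of a concrete pattern is decided by evaluation through the
-- implicit argument, so only the truth of the other side has to be supplied.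
ascent : ∀ {k} {B : Set} (q : Word k) j l {_ : True (lookup q j <? lookup q l)} →
         B → lookup q j < lookup q l ⇔ B
ascent q j l {q<} b = mk⇔ (λ _ → b) (λ _ → toWitness q<)

descent : ∀ {k} {B : Set} (q : Word k) j l {_ : False (lookup q j <? lookup q l)} →
          ¬ B → lookup q j < lookup q l ⇔ B
descent q j l {q≮} ¬b = mk⇔ (⊥-elim ∘ toWitnessFalse q≮) (⊥-elim ∘ ¬b)

-- Counting in lists.

-- Without repetitions every multiplicity is 0 or 1, so equality as sets is already equality as
-- multisets.
unique-↭ : ∀ {A : Set} {xs ys : List A} → Unique xs → Unique ys →
           (∀ {x} → x ∈ xs → x ∈ ys) → (∀ {x} → x ∈ ys → x ∈ xs) → xs ↭ ys
unique-↭ xs! ys! ⊆ ⊇ = ∼bag⇒↭ (unique∧set⇒bag xs! ys! (mk⇔ ⊆ ⊇))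

module _ {A : Set} {P : A → Set} (P? : Decidable P) where

  length-filter-∷ : ∀ x xs → length (filter P? (x ∷ xs)) ≡ length (filter P? [ x ]) + length (filter P? xs)
  length-filter-∷ x xs with P? x
  ... | yes _ = refl
  ... | no  _ = refl

  filter≡[]⇒none : ∀ {xs x} → length (filter P? xs) ≡ 0 → x ∈ xs → ¬ P x
  filter≡[]⇒none {xs} eq x∈xs px with filter P? xs | ∈-filter⁺ P? x∈xs px
  filter≡[]⇒none () x∈xs px | _ ∷ _ | _
  filter≡[]⇒none eq x∈xs px | []    | ()

  sum-constant-on : ∀ (g : A → ℕ) c → (∀ x → P x → g x ≡ c) → (∀ x → ¬ P x → g x ≡ 0) →
                    ∀ xs → sum (map g xs) ≡ length (filter P? xs) * c
  sum-constant-on g c on off []       = refl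
  sum-constant-on g c on off (x ∷ xs) with P? x
  ... | yes px = cong₂ _+_ (on x px) (sum-constant-on g c on off xs)
  ... | no ¬px = cong₂ _+_ (off x ¬px) (sum-constant-on g c on off xs)

sum-map-+ : ∀ {A : Set} (g h : A → ℕ) xs → sum (map (λ x → g x + h x) xs) ≡ sum (map g xs) + sum (map h xs)
sum-map-+ g h []       = refl
sum-map-+ g h (x ∷ xs) = begin
  g x + h x + sum (map (λ x → g x + h x) xs)  ≡⟨ cong (g x + h x +_) (sum-map-+ g h xs) ⟩
  g x + h x + (Σg + Σh)                       ≡⟨ ℕ.+-assoc (g x) (h x) _ ⟩
  g x + (h x + (Σg + Σh))                     ≡⟨ cong (g x +_) (x∙yz≈y∙xz (h x) Σg Σh) ⟩
  g x + (Σg + (h x + Σh))                     ≡⟨ ℕ.+-assoc (g x) Σg _ ⟨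
  g x + Σg + (h x + Σh)                       ∎
  where
  open ≡-Reasoning
  open import Algebra.Properties.CommutativeSemigroup ℕ.+-commutativeSemigroup using (x∙yz≈y∙xz)
  Σg = sum (map g xs)
  Σh = sum (map h xs)

module _ {A B : Set} {R : A → B → Set} (R? : ∀ x y → Dec (R x y)) where

  -- Both sides count the related pairs, by rows and by columns. The induction on `ys` splits one
  -- column `y` off all rows at once.
  double-count : ∀ xs ys → sum (map (λ x → length (filter (R? x) ys)) xs) ≡
                           sum (map (λ y → length (filter (λ x → R? x y) xs)) ys)
  double-count xs [] = go xs
    where
    go : ∀ xs → sum (map (λ _ → 0) xs) ≡ 0
    go []       = refl
    go (_ ∷ xs) = go xs
  double-count xs (y ∷ ys) = begin
    sum (map (λ x → length (filter (R? x) (y ∷ ys))) xs)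
      ≡⟨ cong sum (map-cong (λ x → length-filter-∷ (R? x) y ys) xs) ⟩
    sum (map (λ x → length (filter (R? x) [ y ]) + length (filter (R? x) ys)) xs)
      ≡⟨ sum-map-+ _ _ xs ⟩
    sum (map (λ x → length (filter (R? x) [ y ])) xs) + sum (map (λ x → length (filter (R? x) ys)) xs)
      ≡⟨ cong₂ _+_ (single xs) (double-count xs ys) ⟩
    length (filter (λ x → R? x y) xs) + sum (map (λ y → length (filter (λ x → R? x y) xs)) ys) ∎
    where
    open ≡-Reasoning
    single : ∀ xs → sum (map (λ x → length (filter (R? x) [ y ])) xs) ≡ length (filter (λ x → R? x y) xs)
    single []       = refl
    single (x ∷ xs) with R? x y
    ... | yes _ = cong suc (single xs)
    ... | no  _ = single xs

-- Increasing tuples and binomial coefficients.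

∈-tuples : ∀ {k n} (t : Vec (Fin n) k) → t ∈ tuples k n
∈-tuples []      = here refl
∈-tuples (i ∷ t) = ∈-cartesianProductWith⁺ _∷_ (∈-allFin i) (∈-tuples t)

tuples-unique : ∀ k n → Unique (tuples k n)
tuples-unique zero    n = List.[] ∷ []
tuples-unique (suc k) n = cartesianProductWith⁺ _∷_ ∷-injective (allFin⁺ n) (tuples-unique k n)

lookup-increasing : ∀ {k n} {t : Vec (Fin n) k} → Increasing t → ∀ {j l} → j < l → lookup t j < lookup t l
lookup-increasing (i<t ∷ _)  {zero}  {suc l} _   = VecAll.lookup⁺ i<t l
lookup-increasing (_ ∷ inc)  {suc j} {suc l} j<l = lookup-increasing inc (s<s⁻¹ j<l)

increasing₃ : ∀ {n} {i j l : Fin n} → i < j → j < l → Increasing (i ∷ j ∷ l ∷ [])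
increasing₃ i<j j<l = (i<j ∷ ℕ.<-trans i<j j<l ∷ []) ∷ (j<l ∷ []) ∷ [] ∷ []

shift : ∀ {k n} → Vec (Fin n) k → Vec (Fin (suc n)) k
shift = Vec.map suc

shift-injective : ∀ {k n} {s t : Vec (Fin n) k} → shift s ≡ shift t → s ≡ t
shift-injective {s = []}    {[]}    _  = refl
shift-injective {s = i ∷ s} {j ∷ t} eq with ∷-injective eq
... | i≡j , s≡t = cong₂ _∷_ (suc-injective i≡j) (shift-injective s≡t)

increasing-shift⁺ : ∀ {k n} {t : Vec (Fin n) k} → Increasing t → Increasing (shift t)
increasing-shift⁺ inc = AllPairs.map⁺ (AllPairs.map s<s inc)

increasing-shift⁻ : ∀ {k n} (t : Vec (Fin n) k) → Increasing (shift t) → Increasing t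
increasing-shift⁻ []      _           = []
increasing-shift⁻ (i ∷ t) (i<t ∷ inc) =
  VecAll.map s<s⁻¹ (VecAll.map⁻ i<t) ∷ increasing-shift⁻ t inc

positive⇒shift : ∀ {k n} (t : Vec (Fin (suc n)) k) → VecAll.All (zero {n} <_) t → ∃ λ s → t ≡ shift s
positive⇒shift []          []        = [] , refl
positive⇒shift (suc i ∷ t) (_ ∷ 0<t) with positive⇒shift t 0<t
... | s , refl = i ∷ s , refl

-- The increasing tuples, generated along Pascal's rule: first those that begin with 0, then those
-- in which 0 does not occur.
choices : ∀ k n → List (Vec (Fin n) k)
choices zero    n       = [ [] ]
choices (suc k) zero    = []
choices (suc k) (suc n) = map (λ t → zero ∷ shift t) (choices k n) ++ map shift (choices (suc k) n)

length-choices : ∀ k n → length (choices k n) ≡ n C k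
length-choices zero    n       = refl
length-choices (suc k) zero    = refl
length-choices (suc k) (suc n) = begin
  length (map (λ t → zero ∷ shift t) (choices k n) ++ map shift (choices (suc k) n))
    ≡⟨ length-++ (map _ (choices k n)) ⟩
  length (map (λ t → zero ∷ shift t) (choices k n)) + length (map shift (choices (suc k) n))
    ≡⟨ cong₂ _+_ (length-map _ (choices k n)) (length-map _ (choices (suc k) n)) ⟩
  length (choices k n) + length (choices (suc k) n)
    ≡⟨ cong₂ _+_ (length-choices k n) (length-choices (suc k) n) ⟩
  n C k + n C suc k
    ≡⟨ nCk+nC[k+1]≡[n+1]C[k+1] n k ⟩
  suc n C suc k ∎
  where open ≡-Reasoning

choices-unique : ∀ k n → Unique (choices k n)
choices-unique zero    n       = List.[] ∷ []
choices-unique (suc k) zero    = []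
choices-unique (suc k) (suc n) =
  ++⁺ (map⁺ (shift-injective ∘ proj₂ ∘ ∷-injective) (choices-unique k n))
      (map⁺ shift-injective (choices-unique (suc k) n))
      λ (∈₁ , ∈₂) → disjoint (∈-map⁻ _ ∈₁) (∈-map⁻ _ ∈₂)
  where
  -- Tuples of the first half begin with 0, those of the second half with a successor.
  disjoint : ∀ {t} → ∃ (λ s → s ∈ choices k n × t ≡ zero ∷ shift s) →
             ¬ ∃ (λ s → s ∈ choices (suc k) n × t ≡ shift s)
  disjoint (_ , _ , refl) (_ ∷ _ , _ , ())

-- All entries after the first are positive. Hence the tail is a shifted tuple if the first entry is
-- 0, and otherwise the whole tuple is.
∈-choices⁺ : ∀ {k n} (t : Vec (Fin n) k) → Increasing t → t ∈ choices k n
∈-choices⁺ {n = n}     []           _           = here refl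
∈-choices⁺ {n = suc n} (zero ∷ t)  (0<t ∷ inc) with positive⇒shift t 0<t
... | s , refl = ∈-++⁺ˡ (∈-map⁺ _ (∈-choices⁺ s (increasing-shift⁻ s inc)))
∈-choices⁺ {n = suc n} (suc i ∷ t) (i<t ∷ inc) with positive⇒shift t (VecAll.map (ℕ.<-trans z<s) i<t)
... | s , refl = ∈-++⁺ʳ _ (∈-map⁺ shift (∈-choices⁺ (i ∷ s) (increasing-shift⁻ (i ∷ s) (i<t ∷ inc))))

∈-choices⁻ : ∀ k n {t} → t ∈ choices k n → Increasing t
∈-choices⁻ zero    n       {[]} _ = []
∈-choices⁻ (suc k) (suc n) t∈ with ∈-++⁻ (map _ (choices k n)) t∈
... | inj₁ t∈₁ with ∈-map⁻ _ t∈₁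
...   | s , s∈ , refl = VecAll.map⁺ (VecAll.universal (λ _ → z<s) s) ∷ increasing-shift⁺ (∈-choices⁻ k n s∈)
∈-choices⁻ (suc k) (suc n) t∈ | inj₂ t∈₂ with ∈-map⁻ _ t∈₂
...   | s , s∈ , refl = increasing-shift⁺ (∈-choices⁻ (suc k) n s∈)

increasing? : ∀ {k n} (t : Vec (Fin n) k) → Dec (Increasing t)
increasing? = AllPairs.allPairs? _<?_

length-increasing : ∀ k n → length (filter increasing? (tuples k n)) ≡ n C k
length-increasing k n = trans
  (↭-length (unique-↭ (filter⁺ increasing? (tuples-unique k n)) (choices-unique k n)
    (λ t∈ → ∈-choices⁺ _ (proj₂ (∈-filter⁻ increasing? {xs = tuples k n} t∈)))
    (λ t∈ → ∈-filter⁺ increasing? (∈-tuples _) (∈-choices⁻ k n t∈))))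
  (length-choices k n)

-- Occurrences and avoidance of patterns.

avoids⇒¬occurrence : ∀ {k n} (q : Word k) (σ : Word n) → Avoids q σ → ∀ t → ¬ IsOccurrence q σ t
avoids⇒¬occurrence q σ av t = filter≡[]⇒none (isOccurrence? q σ) av (∈-tuples t)

¬occurrence⇒avoids : ∀ {k n} (q : Word k) (σ : Word n) → (∀ t → ¬ IsOccurrence q σ t) → Avoids q σ
¬occurrence⇒avoids {k} {n} q σ none =
  cong length (filter-none (isOccurrence? q σ) {tuples k n} (List.tabulate λ {t} _ → none t))

-- It suffices to compare pairs `j < l`: on the diagonal both sides are false, and a reversed pair
-- follows by trichotomy, since neither word repeats a value.
sameOrder⁺ : ∀ {k n} {q : Word k} {σ : Word n} {t} → IsPermutation q → IsPermutation σ → Increasing t →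
             (∀ {j l} → j < l → lookup q j < lookup q l ⇔ lookup σ (lookup t j) < lookup σ (lookup t l)) →
             SameOrder q σ t
sameOrder⁺ {q = q} {σ} {t} q! σ! inc ascents j l with <-cmp j l
... | tri< j<l _ _  = ascents j<l
... | tri≈ _ refl _ = mk⇔ (λ q< → contradiction q< (ℕ.<-irrefl refl)) (λ σ< → contradiction σ< (ℕ.<-irrefl refl))
... | tri> _ _ l<j  = mk⇔ to′ from′
  where
  to′ : lookup q j < lookup q l → lookup σ (lookup t j) < lookup σ (lookup t l)
  to′ q< with <-cmp (lookup σ (lookup t j)) (lookup σ (lookup t l))
  ... | tri< σ< _ _ = σ<
  ... | tri≈ _ σ≡ _ = contradiction (cong toℕ (sym (lookup-injective σ! _ _ σ≡)))
                        (ℕ.<⇒≢ (lookup-increasing inc l<j))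
  ... | tri> _ _ σ> = contradiction q< (ℕ.<-asym (from (ascents l<j) σ>))
  from′ : lookup σ (lookup t j) < lookup σ (lookup t l) → lookup q j < lookup q l
  from′ σ< with <-cmp (lookup q j) (lookup q l)
  ... | tri< q< _ _ = q<
  ... | tri≈ _ q≡ _ = contradiction (cong toℕ (sym (lookup-injective q! _ _ q≡))) (ℕ.<⇒≢ l<j)
  ... | tri> _ _ q> = contradiction σ< (ℕ.<-asym (to (ascents l<j) q>))

pairs₃ : ∀ {R : Fin 3 → Fin 3 → Set} → R 0F 1F → R 0F 2F → R 1F 2F → ∀ {j l} → j < l → R j l
pairs₃ r₀₁ r₀₂ r₁₂ {0F} {1F} _ = r₀₁
pairs₃ r₀₁ r₀₂ r₁₂ {0F} {2F} _ = r₀₂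
pairs₃ r₀₁ r₀₂ r₁₂ {1F} {2F} _ = r₁₂
pairs₃ r₀₁ r₀₂ r₁₂ {1F} {1F} (s<s ())
pairs₃ r₀₁ r₀₂ r₁₂ {2F} {1F} (s<s ())
pairs₃ r₀₁ r₀₂ r₁₂ {2F} {2F} (s<s (s<s ()))

-- Words with a peak.

-- The maximum of σ sits at p and the other entries are decreasing.
PeakAt : ∀ {n} → Fin n → Word n → Set
PeakAt p σ = ∀ {a b} → a < b → (b ≡ p → lookup σ a < lookup σ b) × (b ≢ p → lookup σ b < lookup σ a)

module _ {n} {p : Fin n} (σ : Word n) (peak : PeakAt p σ) where

  peak-ascent⇔ : ∀ {a b} → a < b → lookup σ a < lookup σ b ⇔ b ≡ p
  peak-ascent⇔ {a} {b} a<b = mk⇔ to′ (proj₁ (peak a<b))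
    where
    to′ : lookup σ a < lookup σ b → b ≡ p
    to′ σ< with b ≟ p
    ... | yes b≡p = b≡p
    ... | no  b≢p = contradiction σ< (ℕ.<-asym (proj₂ (peak a<b) b≢p))

  peak-≢ : ∀ {a b} → a < b → lookup σ a ≢ lookup σ b
  peak-≢ {a} {b} a<b σ≡ with b ≟ p
  ... | yes b≡p = ℕ.<⇒≢ (proj₁ (peak a<b) b≡p) (cong toℕ σ≡)
  ... | no  b≢p = ℕ.<⇒≢ (proj₂ (peak a<b) b≢p) (cong toℕ (sym σ≡))

  -- `PeakAt` gives a strict comparison, in one direction or the other, between the entries at any
  -- two distinct positions.
  peak-unique : IsPermutation σ
  peak-unique = subst IsPermutation (tabulate∘lookup σ) (Unique.tabulate⁺ injective)
    where
    injective : ∀ {a b} → lookup σ a ≡ lookup σ b → a ≡ b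
    injective {a} {b} σ≡ with <-cmp a b
    ... | tri< a<b _ _ = contradiction σ≡ (peak-≢ a<b)
    ... | tri≈ _ a≡b _ = a≡b
    ... | tri> _ _ b<a = contradiction (sym σ≡) (peak-≢ b<a)

  -- The entries at `a < b` rise exactly when `b` is the peak, so being order-isomorphic to `q`
  -- becomes a condition on positions alone, free of the values of `σ`.
  peak-sameOrder⇔ : ∀ {k} {q : Word k} {t} → IsPermutation q → Increasing t →
                    SameOrder q σ t ⇔ (∀ {j l} → j < l → lookup q j < lookup q l ⇔ lookup t l ≡ p)
  peak-sameOrder⇔ {q = q} {t} q! inc = mk⇔
    (λ so {j} {l} j<l → let e = peak-ascent⇔ (lookup-increasing inc j<l) in
      mk⇔ (to e ∘ to (so j l)) (from (so j l) ∘ from e))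
    (λ asc → sameOrder⁺ {q = q} {σ} {t} q! peak-unique inc
      (λ j<l → let e = peak-ascent⇔ (lookup-increasing inc j<l) in
        mk⇔ (from e ∘ to (asc j<l)) (from (asc j<l) ∘ to e)))

-- Strictly monotone maps on finite ordinals.

-- The values start at 0 or more and gain at least 1 with each step.
increasing⇒≤ : ∀ {m} (g : Fin m → ℕ) → (∀ {i j} → i < j → g i ℕ.< g j) → ∀ i → toℕ i ℕ.≤ g i
increasing⇒≤ g mono zero    = z≤n
increasing⇒≤ g mono (suc i) = ℕ.≤-<-trans
  (subst (ℕ._≤ g (inject₁ i)) (toℕ-inject₁ i) (ih i)) (mono (ℕ.≤-reflexive (cong suc (toℕ-inject₁ i))))
  where
  -- Restricting `g` along `inject₁` makes the recursive call one at `i` itself, which is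
  -- structurally smaller than `suc i`.
  ih : ∀ i → toℕ (inject₁ i) ℕ.≤ g (inject₁ i)
  ih i = subst (ℕ._≤ g (inject₁ i)) (sym (toℕ-inject₁ i))
    (increasing⇒≤ (g ∘ inject₁)
      (λ {a} {b} a<b → mono (subst₂ ℕ._<_ (sym (toℕ-inject₁ a)) (sym (toℕ-inject₁ b)) a<b)) i)

opposite-anti-≤ : ∀ {n} {i j : Fin n} → i ≤ j → opposite j ≤ opposite i
opposite-anti-≤ {n} {i} {j} i≤j =
  subst₂ ℕ._≤_ (sym (opposite-prop j)) (sym (opposite-prop i)) (ℕ.∸-monoʳ-≤ n (s≤s i≤j))

opposite-anti-< : ∀ {n} {i j : Fin n} → i < j → opposite j < opposite i
opposite-anti-< {n} {i} {j} i<j =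
  subst₂ ℕ._<_ (sym (opposite-prop j)) (sym (opposite-prop i)) (ℕ.∸-monoʳ-< (s≤s i<j) (toℕ<n j))

-- Composing `g` with `opposite` on either side gives an increasing map, which dominates the
-- identity. The composite with `opposite` outside bounds `g i` from above by `opposite i`, the one
-- with it inside from below.
decreasing⇒opposite : ∀ {n} (g : Fin n → Fin n) → (∀ {i j} → i < j → g j < g i) → ∀ i → g i ≡ opposite i
decreasing⇒opposite g anti i = toℕ-injective (ℕ.≤-antisym
  (subst (_≤ opposite i) (opposite-involutive (g i))
    (opposite-anti-≤ {j = opposite (g i)} (increasing⇒≤ (toℕ ∘ opposite ∘ g) (opposite-anti-< ∘ anti) i)))
  (subst (λ j → opposite i ≤ g j) (opposite-involutive i)
    (increasing⇒≤ (toℕ ∘ g ∘ opposite) (anti ∘ opposite-anti-<) (opposite i))))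

-- The word with a prescribed peak.

-- This is the word m-1, ..., 1, 0 with the largest value m inserted at position `p`.
peakWord : ∀ {m} → Fin (suc m) → Word (suc m)
peakWord {m} p = insertAt (tabulate (inject₁ ∘ opposite)) p (fromℕ m)

peakWord-peak : ∀ {m} (p : Fin (suc m)) → lookup (peakWord p) p ≡ fromℕ m
peakWord-peak p = insertAt-lookup _ p _

peakWord-punchIn : ∀ {m} (p : Fin (suc m)) j → lookup (peakWord p) (punchIn p j) ≡ inject₁ (opposite j)
peakWord-punchIn p j = trans (insertAt-punchIn _ p _ j) (lookup∘tabulate (inject₁ ∘ opposite) j)

-- The two cases match the two lookup laws of `insertAt`: a position either holds the inserted entry
-- or comes from the original vector.
data PunchView {m} (p : Fin (suc m)) : Fin (suc m) → Set where
  hole  : PunchView p p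
  punch : ∀ j → PunchView p (punchIn p j)

punchView : ∀ {m} (p a : Fin (suc m)) → PunchView p a
punchView p a with p ≟ a
... | yes refl = hole
... | no  p≢a  = subst (PunchView p) (punchIn-punchOut p≢a) (punch (punchOut p≢a))

punchIn-mono-< : ∀ {m} (p : Fin (suc m)) {i j} → i < j → punchIn p i < punchIn p j
punchIn-mono-< p {i} {j} i<j = ≤∧≢⇒< (punchIn-mono-≤ p i j (ℕ.<⇒≤ i<j))
  (λ eq → ℕ.<⇒≢ i<j (cong toℕ (punchIn-injective p i j eq)))

punchIn-cancel-< : ∀ {m} (p : Fin (suc m)) {i j} → punchIn p i < punchIn p j → i < j
punchIn-cancel-< p {i} {j} pi<pj = ≤∧≢⇒< (punchIn-cancel-≤ p i j (ℕ.<⇒≤ pi<pj))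
  (λ eq → ℕ.<⇒≢ pi<pj (cong (toℕ ∘ punchIn p) eq))

peakWord-<-peak : ∀ {m} (p : Fin (suc m)) j → lookup (peakWord p) (punchIn p j) < lookup (peakWord p) p
peakWord-<-peak {m} p j
  rewrite peakWord-punchIn p j | peakWord-peak p | toℕ-inject₁ (opposite j) | toℕ-fromℕ m = toℕ<n _

peakWord-peakAt : ∀ {m} (p : Fin (suc m)) → PeakAt p (peakWord p)
peakWord-peakAt p {a} {b} a<b with punchView p a | punchView p b
... | hole    | hole    = contradiction a<b (ℕ.<-irrefl refl)
... | hole    | punch j = (λ eq → contradiction eq (punchInᵢ≢i p j)) , λ _ → peakWord-<-peak p j
... | punch i | hole    = (λ _ → peakWord-<-peak p i) , (λ p≢p → contradiction refl p≢p)
... | punch i | punch j = (λ eq → contradiction eq (punchInᵢ≢i p j)) , λ _ → below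
  where
  below : lookup (peakWord p) (punchIn p j) < lookup (peakWord p) (punchIn p i)
  below rewrite peakWord-punchIn p i | peakWord-punchIn p j
              | toℕ-inject₁ (opposite i) | toℕ-inject₁ (opposite j) =
    opposite-anti-< {i = i} {j} (punchIn-cancel-< p a<b)

-- Reading σ at its peak and then from left to right gives a decreasing sequence of all values.
peakAt⇒peakWord : ∀ {m} {p : Fin (suc m)} {σ} → PeakAt p σ → σ ≡ peakWord p
peakAt⇒peakWord {m} {p} {σ} peak = begin
  σ                              ≡⟨ tabulate∘lookup σ ⟨
  tabulate (lookup σ)            ≡⟨ tabulate-cong agree ⟩
  tabulate (lookup (peakWord p)) ≡⟨ tabulate∘lookup (peakWord p) ⟩
  peakWord p                     ∎
  where
  open ≡-Reasoning
  g : Fin (suc m) → Fin (suc m)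
  g zero    = lookup σ p
  g (suc j) = lookup σ (punchIn p j)
  anti : ∀ {i j} → i < j → g j < g i
  anti {zero} {suc j} _ with <-cmp p (punchIn p j)
  ... | tri< p<j _ _ = proj₂ (peak p<j) (punchInᵢ≢i p j)
  ... | tri≈ _ eq _  = contradiction (sym eq) (punchInᵢ≢i p j)
  ... | tri> _ _ j<p = proj₁ (peak j<p) refl
  anti {suc i} {suc j} i<j = proj₂ (peak (punchIn-mono-< p (s<s⁻¹ i<j))) (punchInᵢ≢i p j)
  agree : ∀ a → lookup σ a ≡ lookup (peakWord p) a
  agree a with punchView p a
  ... | hole    = trans (decreasing⇒opposite g anti zero) (sym (peakWord-peak p))
  ... | punch j = trans (decreasing⇒opposite g anti (suc j)) (sym (peakWord-punchIn p j))

-- The avoiders of 123, 132 and 312 are the words with a peak.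

p123! : IsPermutation p123
p123! = toWitness {a? = isPermutation? p123} _

p132! : IsPermutation p132
p132! = toWitness {a? = isPermutation? p132} _

p213! : IsPermutation p213
p213! = toWitness {a? = isPermutation? p213} _

p231! : IsPermutation p231
p231! = toWitness {a? = isPermutation? p231} _

p312! : IsPermutation p312
p312! = toWitness {a? = isPermutation? p312} _

p321! : IsPermutation p321
p321! = toWitness {a? = isPermutation? p321} _

-- Maximality is taken in the weak form that `argmax` delivers; distinctness of the entries makes it
-- strict, and likewise turns the absence of a rise into a descent.
avoider⇒peakAt-maximum : ∀ {n} {σ : Word n} → IsPermutation σ →
  Avoids p123 σ → Avoids p132 σ → Avoids p312 σ →
  ∀ p → (∀ a → lookup σ a ≤ lookup σ p) → PeakAt p σ
avoider⇒peakAt-maximum {n} {σ} σ! av123 av132 av312 p maximal a<b = up a<b , down a<b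
  where
  up : ∀ {a b} → a < b → b ≡ p → lookup σ a < lookup σ b
  up {a} a<b refl = ≤∧≢⇒< (maximal a) (λ σ≡ → ℕ.<⇒≢ a<b (cong toℕ (lookup-injective σ! _ _ σ≡)))
  occurs : ∀ q → IsPermutation q → ∀ {i j l : Fin n} → i < j → j < l →
           (lookup q 0F < lookup q 1F ⇔ lookup σ i < lookup σ j) →
           (lookup q 0F < lookup q 2F ⇔ lookup σ i < lookup σ l) →
           (lookup q 1F < lookup q 2F ⇔ lookup σ j < lookup σ l) →
           IsOccurrence q σ (i ∷ j ∷ l ∷ [])
  occurs q q! {i} {j} {l} i<j j<l e₀₁ e₀₂ e₁₂ = increasing₃ i<j j<l ,
    sameOrder⁺ {q = q} q! σ! (increasing₃ i<j j<l)
      (pairs₃ {λ a b → lookup q a < lookup q b ⇔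
                 lookup σ (lookup (i ∷ j ∷ l ∷ []) a) < lookup σ (lookup (i ∷ j ∷ l ∷ []) b)} e₀₁ e₀₂ e₁₂)
  noRise : ∀ {a b} → a < b → b ≢ p → ¬ lookup σ a < lookup σ b
  noRise {a} {b} a<b b≢p σ< with <-cmp a p | <-cmp b p
  ... | tri≈ _ refl _ | _            = ℕ.≤⇒≯ (maximal b) σ<
  ... | _             | tri≈ _ b≡p _ = b≢p b≡p
  ... | tri< a<p _ _  | tri< b<p _ _ = avoids⇒¬occurrence p123 σ av123 (a ∷ b ∷ p ∷ [])
    (occurs p123 p123! a<b b<p
      (ascent p123 0F 1F σ<) (ascent p123 0F 2F (up a<p refl)) (ascent p123 1F 2F (up b<p refl)))
  ... | tri< a<p _ _  | tri> _ _ p<b = avoids⇒¬occurrence p132 σ av132 (a ∷ p ∷ b ∷ [])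
    (occurs p132 p132! a<p p<b
      (ascent p132 0F 1F (up a<p refl)) (ascent p132 0F 2F σ<) (descent p132 1F 2F (ℕ.≤⇒≯ (maximal b))))
  -- Here `a < b` already places `b` to the right of `p`.
  ... | tri> _ _ p<a  | _            = avoids⇒¬occurrence p312 σ av312 (p ∷ a ∷ b ∷ [])
    (occurs p312 p312! p<a a<b
      (descent p312 0F 1F (ℕ.≤⇒≯ (maximal a))) (descent p312 0F 2F (ℕ.≤⇒≯ (maximal b))) (ascent p312 1F 2F σ<))
  down : ∀ {a b} → a < b → b ≢ p → lookup σ b < lookup σ a
  down {a} {b} a<b b≢p = ≤∧≢⇒< (ℕ.≮⇒≥ (noRise a<b b≢p))
    (λ σ≡ → ℕ.<⇒≢ a<b (cong toℕ (sym (lookup-injective σ! _ _ σ≡))))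

avoider⇒peakAt : ∀ {m} {σ : Word (suc m)} → IsPermutation σ →
                 Avoids p123 σ → Avoids p132 σ → Avoids p312 σ → ∃ λ p → PeakAt p σ
avoider⇒peakAt {m} {σ} σ! av123 av132 av312 =
  p , avoider⇒peakAt-maximum σ! av123 av132 av312 p
        (λ a → List.lookup (f[xs]≤f[argmax] {f = toℕ ∘ lookup σ} zero (allFin (suc m))) (∈-allFin a))
  where
  p : Fin (suc m)
  -- The default `zero` is itself a position, and `allFin` lists every position, so the result
  -- maximises over all of them.
  p = argmax (toℕ ∘ lookup σ) zero (allFin (suc m))

-- In 123 and 132 both later letters exceed the first, so two different positions would have to be
-- the peak. In 312 the last letter exceeds the second, which makes its position the peak, and then
-- it would have to exceed the first letter too.
peakAt⇒avoids : ∀ {n} {p : Fin n} {σ} → PeakAt p σ → Avoids p123 σ × Avoids p132 σ × Avoids p312 σ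
peakAt⇒avoids {p = p} {σ} peak =
  ¬occurrence⇒avoids p123 σ no123 , ¬occurrence⇒avoids p132 σ no132 , ¬occurrence⇒avoids p312 σ no312
  where
  ascents : ∀ q → IsPermutation q → ∀ {t} → IsOccurrence q σ t →
            ∀ {j l : Fin 3} → j < l → lookup q j < lookup q l ⇔ lookup t l ≡ p
  ascents q q! {t} (inc , so) = to (peak-sameOrder⇔ σ peak {q = q} {t} q! inc) so
  clash : ∀ {t : Vec (Fin _) 3} → Increasing t → lookup t 1F ≡ p → ¬ lookup t 2F ≡ p
  clash {t} inc t₁≡p t₂≡p =
    ℕ.<⇒≢ (lookup-increasing {t = t} inc {1F} {2F} (s<s z<s)) (cong toℕ (trans t₁≡p (sym t₂≡p)))
  no123 : ∀ t → ¬ IsOccurrence p123 σ t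
  no123 t occ = clash {t} (proj₁ occ)
    (to (ascents p123 p123! {t} occ {0F} {1F} z<s) z<s)
    (to (ascents p123 p123! {t} occ {0F} {2F} z<s) z<s)
  no132 : ∀ t → ¬ IsOccurrence p132 σ t
  no132 t occ = clash {t} (proj₁ occ)
    (to (ascents p132 p132! {t} occ {0F} {1F} z<s) z<s)
    (to (ascents p132 p132! {t} occ {0F} {2F} z<s) z<s)
  no312 : ∀ t → ¬ IsOccurrence p312 σ t
  no312 t occ with s<s () ← from (ascents p312 p312! {t} occ {0F} {2F} z<s)
                              (to (ascents p312 p312! {t} occ {1F} {2F} (s<s z<s)) z<s)

avoidsAll? : ∀ {n} (σ : Word n) → Dec (Avoids p123 σ × Avoids p132 σ × Avoids p312 σ)
avoidsAll? σ = avoids? p123 σ ×-dec avoids? p132 σ ×-dec avoids? p312 σ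

avoiders-unique : ∀ n → Unique (avoiders n)
avoiders-unique n = filter⁺ avoidsAll? (filter⁺ isPermutation? (tuples-unique n n))

∈-avoiders⁺ : ∀ n {σ : Word n} → IsPermutation σ → Avoids p123 σ × Avoids p132 σ × Avoids p312 σ → σ ∈ avoiders n
∈-avoiders⁺ n {σ} σ! av =
  ∈-filter⁺ avoidsAll? {σ} {permutations n} (∈-filter⁺ isPermutation? {σ} {tuples n n} (∈-tuples σ) σ!) av

∈-avoiders⁻ : ∀ n {σ : Word n} → σ ∈ avoiders n → IsPermutation σ × Avoids p123 σ × Avoids p132 σ × Avoids p312 σ
∈-avoiders⁻ n {σ} σ∈ = let σ∈perms , av = ∈-filter⁻ avoidsAll? {σ} {permutations n} σ∈ in
  proj₂ (∈-filter⁻ isPermutation? {σ} {tuples n n} σ∈perms) , av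

-- Both `p` and `r` hold the largest value in the same word, whose entries are distinct.
peakWord-injective : ∀ {m} {p r : Fin (suc m)} → peakWord p ≡ peakWord r → p ≡ r
peakWord-injective {m} {p} {r} eq = lookup-injective (peak-unique (peakWord r) (peakWord-peakAt r)) p r (begin
  lookup (peakWord r) p  ≡⟨ cong (λ σ → lookup σ p) eq ⟨
  lookup (peakWord p) p  ≡⟨ peakWord-peak p ⟩
  fromℕ m                ≡⟨ peakWord-peak r ⟨
  lookup (peakWord r) r  ∎)
  where open ≡-Reasoning

∈-avoiders⇒peakAt : ∀ m {σ} → σ ∈ avoiders (suc m) → ∃ λ p → PeakAt p σ
∈-avoiders⇒peakAt m {σ} σ∈ = let σ! , av123 , av132 , av312 = ∈-avoiders⁻ (suc m) {σ} σ∈ in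
  avoider⇒peakAt {σ = σ} σ! av123 av132 av312

peakWord∈avoiders : ∀ {m} (p : Fin (suc m)) → peakWord p ∈ avoiders (suc m)
peakWord∈avoiders {m} p = ∈-avoiders⁺ (suc m) {peakWord p} (peak-unique (peakWord p) (peakWord-peakAt p))
  (peakAt⇒avoids {p = p} {peakWord p} (peakWord-peakAt p))

avoiders-↭ : ∀ m → avoiders (suc m) ↭ map peakWord (allFin (suc m))
avoiders-↭ m = unique-↭ {xs = avoiders (suc m)} {map peakWord (allFin (suc m))}
  (avoiders-unique (suc m)) (map⁺ peakWord-injective (allFin⁺ (suc m)))
  (λ {σ} σ∈ → let p , peak = ∈-avoiders⇒peakAt m {σ} σ∈ in
    subst (_∈ map peakWord (allFin (suc m))) (sym (peakAt⇒peakWord {p = p} {σ} peak))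
      (∈-map⁺ peakWord (∈-allFin p)))
  (λ {σ} σ∈ → let p , _ , σ≡ = ∈-map⁻ peakWord {σ} {allFin (suc m)} σ∈ in
    subst (_∈ avoiders (suc m)) (sym σ≡) (peakWord∈avoiders p))

-- Double counting of tuples and peaks.

-- Once the order of summation is exchanged, each increasing tuple contributes `c` and every other
-- tuple 0, as no word has an occurrence there.
f-constant : ∀ {k} (q : Word k) m c →
             (∀ t → Increasing t → length (filter (λ p → isOccurrence? q (peakWord p) t) (allFin (suc m))) ≡ c) →
             f q (suc m) ≡ c * (suc m C k)
f-constant {k} q m c count = begin
  sum (map (occurrences q) (avoiders (suc m)))
    ≡⟨ sum-↭ (↭.map⁺ (occurrences q) (avoiders-↭ m)) ⟩
  sum (map (occurrences q) (map peakWord (allFin (suc m))))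
    ≡⟨ cong sum (map-∘ (allFin (suc m))) ⟨
  sum (map (λ p → occurrences q (peakWord p)) (allFin (suc m)))
    ≡⟨ double-count (λ p → isOccurrence? q (peakWord p)) (allFin (suc m)) (tuples k (suc m)) ⟩
  sum (map (λ t → length (filter (λ p → isOccurrence? q (peakWord p) t) (allFin (suc m)))) (tuples k (suc m)))
    ≡⟨ sum-constant-on increasing? _ c count none (tuples k (suc m)) ⟩
  length (filter increasing? (tuples k (suc m))) * c
    ≡⟨ cong (_* c) (length-increasing k (suc m)) ⟩
  (suc m C k) * c
    ≡⟨ ℕ.*-comm (suc m C k) c ⟩
  c * (suc m C k) ∎
  where
  open ≡-Reasoning
  none : ∀ t → ¬ Increasing t → length (filter (λ p → isOccurrence? q (peakWord p) t) (allFin (suc m))) ≡ 0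
  none t ¬inc = cong length (filter-none (λ p → isOccurrence? q (peakWord p) t) {allFin (suc m)}
    (List.tabulate (λ _ → ¬inc ∘ proj₁)))

-- The peaks that suit a given triple.

length-filter-singleton : ∀ {n} {P : Fin n → Set} (P? : Decidable P) x → (∀ p → P p ⇔ p ≡ x) →
                          length (filter P? (allFin n)) ≡ 1
length-filter-singleton {n} P? x P⇔ = ↭-length (unique-↭ {ys = [ x ]} (filter⁺ P? (allFin⁺ n)) ([] ∷ [])
  (λ p∈ → here (to (P⇔ _) (proj₂ (∈-filter⁻ P? {xs = allFin n} p∈))))
  (λ { (here refl) → ∈-filter⁺ P? (∈-allFin x) (from (P⇔ x) refl) }))

-- Putting `x` and `y` back in front of the filtered list yields every position exactly once, so the
-- list with these two added has length `n`.
length-filter-copair : ∀ {n} {P : Fin n → Set} (P? : Decidable P) {x y} → x ≢ y →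
                       (∀ p → P p ⇔ (p ≢ x × p ≢ y)) → length (filter P? (allFin n)) ≡ n ∸ 2
length-filter-copair {n} P? {x} {y} x≢y P⇔ = cong (_∸ 2) (trans
  (↭-length (unique-↭ {xs = x ∷ y ∷ filter P? (allFin n)}
    ((x≢y ∷ List.tabulate (λ p∈ x≡p → proj₁ (other p∈) (sym x≡p)))
      ∷ List.tabulate (λ p∈ y≡p → proj₂ (other p∈) (sym y≡p))
      ∷ filter⁺ P? (allFin⁺ n))
    (allFin⁺ n) (λ _ → ∈-allFin _) (λ _ → cover _)))
  (length-tabulate {n = n} _))
  where
  other : ∀ {p} → p ∈ filter P? (allFin n) → p ≢ x × p ≢ y
  other p∈ = to (P⇔ _) (proj₂ (∈-filter⁻ P? {xs = allFin n} p∈))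
  cover : ∀ p → p ∈ x ∷ y ∷ filter P? (allFin n)
  cover p with p ≟ x | p ≟ y
  ... | yes p≡x | _       = here p≡x
  ... | no _    | yes p≡y = there (here p≡y)
  ... | no p≢x  | no p≢y  = there (there (∈-filter⁺ P? (∈-allFin p) (from (P⇔ p) (p≢x , p≢y))))

-- A rise is recognised by its right end, so only `j` and `l`, the right ends of the three pairs,
-- are compared with the peak.
occurrence₃⇔ : ∀ {m} (q : Word 3) → IsPermutation q → ∀ {i j l : Fin (suc m)} (p : Fin (suc m)) →
               Increasing (i ∷ j ∷ l ∷ []) →
               IsOccurrence q (peakWord p) (i ∷ j ∷ l ∷ []) ⇔
               ((lookup q 0F < lookup q 1F ⇔ j ≡ p) × (lookup q 0F < lookup q 2F ⇔ l ≡ p) ×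
                (lookup q 1F < lookup q 2F ⇔ l ≡ p))
occurrence₃⇔ q q! {i} {j} {l} p inc = mk⇔
  (λ (_ , so) → let asc = to ascents⇔ so in asc {0F} {1F} z<s , asc {0F} {2F} z<s , asc {1F} {2F} (s<s z<s))
  (λ (e₀₁ , e₀₂ , e₁₂) → inc , from ascents⇔
    (pairs₃ {λ a b → lookup q a < lookup q b ⇔ lookup (i ∷ j ∷ l ∷ []) b ≡ p} e₀₁ e₀₂ e₁₂))
  where
  ascents⇔ : SameOrder q (peakWord p) (i ∷ j ∷ l ∷ []) ⇔
             (∀ {a b} → a < b → lookup q a < lookup q b ⇔ lookup (i ∷ j ∷ l ∷ []) b ≡ p)
  ascents⇔ = peak-sameOrder⇔ (peakWord p) (peakWord-peakAt p) {q = q} q! inc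

module _ {m} (p : Fin (suc m)) {i j l : Fin (suc m)} (inc : Increasing (i ∷ j ∷ l ∷ [])) where

  private
    j≢l : j ≢ l
    j≢l j≡l = ℕ.<⇒≢ (lookup-increasing inc {1F} {2F} (s<s z<s)) (cong toℕ j≡l)

  -- The rising pairs of 213 are exactly those that end at its third letter.
  occurrence213⇔ : IsOccurrence p213 (peakWord p) (i ∷ j ∷ l ∷ []) ⇔ p ≡ l
  occurrence213⇔ = mk⇔
    (λ occ → let _ , e₀₂ , _ = to occ⇔ occ in sym (to e₀₂ (s<s z<s)))
    (λ { refl → from occ⇔ (descent p213 0F 1F j≢l , ascent p213 0F 2F refl , ascent p213 1F 2F refl) })
    where occ⇔ = occurrence₃⇔ p213 p213! p inc

  -- The only rising pair of 231 ends at its second letter.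
  occurrence231⇔ : IsOccurrence p231 (peakWord p) (i ∷ j ∷ l ∷ []) ⇔ p ≡ j
  occurrence231⇔ = mk⇔
    (λ occ → let e₀₁ , _ = to occ⇔ occ in sym (to e₀₁ (s<s z<s)))
    (λ { refl → from occ⇔
      (ascent p231 0F 1F refl , descent p231 0F 2F (j≢l ∘ sym) , descent p231 1F 2F (j≢l ∘ sym)) })
    where occ⇔ = occurrence₃⇔ p231 p231! p inc

  -- As 321 has no rising pair, neither `j` nor `l` can be the peak; `i` can, since it is the right
  -- end of no pair.
  occurrence321⇔ : IsOccurrence p321 (peakWord p) (i ∷ j ∷ l ∷ []) ⇔ (p ≢ j × p ≢ l)
  occurrence321⇔ = mk⇔
    (λ occ → let e₀₁ , e₀₂ , _ = to occ⇔ occ in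
      (λ p≡j → contradiction (from e₀₁ (sym p≡j)) λ { (s<s ()) }) ,
      (λ p≡l → contradiction (from e₀₂ (sym p≡l)) λ()))
    (λ (p≢j , p≢l) → from occ⇔
      (descent p321 0F 1F (p≢j ∘ sym) , descent p321 0F 2F (p≢l ∘ sym) , descent p321 1F 2F (p≢l ∘ sym)))
    where occ⇔ = occurrence₃⇔ p321 p321! p inc

theorem3p7 : ∀ (n : ℕ) → n ≥ 3 →
    (f p213 n ≡ n C 3) × (f p231 n ≡ n C 3) × (f p321 n ≡ (n ∸ 2) * (n C 3))
theorem3p7 (suc m) _ =
  trans (f-constant p213 m 1 count213) (ℕ.*-identityˡ _) ,
  trans (f-constant p231 m 1 count231) (ℕ.*-identityˡ _) ,
  f-constant p321 m (suc m ∸ 2) count321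
  where
  count : Word 3 → Vec (Fin (suc m)) 3 → ℕ
  count q t = length (filter (λ p → isOccurrence? q (peakWord p) t) (allFin (suc m)))
  count213 : ∀ t → Increasing t → count p213 t ≡ 1
  count213 t@(_ ∷ _ ∷ l ∷ []) inc =
    length-filter-singleton (λ p → isOccurrence? p213 (peakWord p) t) l (λ p → occurrence213⇔ p inc)
  count231 : ∀ t → Increasing t → count p231 t ≡ 1
  count231 t@(_ ∷ j ∷ _ ∷ []) inc =
    length-filter-singleton (λ p → isOccurrence? p231 (peakWord p) t) j (λ p → occurrence231⇔ p inc)
  count321 : ∀ t → Increasing t → count p321 t ≡ suc m ∸ 2
  count321 t@(_ ∷ _ ∷ _ ∷ []) inc@(_ ∷ (j<l ∷ []) ∷ _) =
    length-filter-copair (λ p → isOccurrence? p321 (peakWord p) t) (ℕ.<⇒≢ j<l ∘ cong toℕ)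
      (λ p → occurrence321⇔ p inc)
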